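{- Let $n\ge 1$ and let $p=p_1\cdots p_n$ be a permutation of $\{1,\dots,n\}$ with $p_n=1$. Then the following are equivalent: (A) $p$ is strongly 312-avoiding; (B) there is an integer $k$ with $n/2\le k\le n$ such that $p=(k+1)(k+2)\cdots n\; k(k-1)\cdots 2\,1$, i.e. $p$ lists the $n-k$ largest values in increasing order followed by the $k$ smallest values in decreasing order.
   Context: Permutations are written in one-line notation $p=p_1\cdots p_n$ with $p_i=p(i)$. $p$ contains a pattern $q=q_1\cdots q_m$ if there are indices $i_1<\cdots<i_m$ with $p_{i_r}<p_{i_s}$ iff $q_r<q_s$; otherwise $p$ avoids $q$. $p^2(i)=p(p(i))$. A permutation $p$ is strongly $q$-avoiding if both $p$ and $p^2$ avoid $q$. -}

module Defs where

open import Data.Fin.Base using (Fin; toℕ; _<_)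
open import Data.Fin.Patterns using (0F; 1F; 2F)
open import Data.Fin.Permutation using (Permutation′; permutation; _⟨$⟩ʳ_; _∘ₚ_)
open import Data.List.Base using (List; _++_; map; upTo; downFrom; tabulate)
open import Data.Nat.Base using (ℕ; suc; _+_; _∸_)
open import Data.Product.Base using (_×_; Σ-syntax)
open import Function.Bundles using (_⇔_)
open import Relation.Binary.PropositionalEquality.Core using (_≡_; refl)
open import Relation.Nullary.Negation using (¬_)

-- A permutation of {1,…,n} is a bijection on Fin n; the element i of {1,…,n}
-- is the index whose toℕ is i ∸ 1.

Contains : ∀ {n m} → Permutation′ n → Permutation′ m → Set
Contains {n} {m} p q = Σ[ i ∈ (Fin m → Fin n) ]
  (∀ (r s : Fin m) → r < s → i r < i s) ×
  (∀ (r s : Fin m) → (p ⟨$⟩ʳ i r < p ⟨$⟩ʳ i s) ⇔ (q ⟨$⟩ʳ r < q ⟨$⟩ʳ s))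

Avoids : ∀ {n m} → Permutation′ n → Permutation′ m → Set
Avoids p q = ¬ Contains p q

StronglyAvoids : ∀ {n m} → Permutation′ n → Permutation′ m → Set
StronglyAvoids p q = Avoids p q × Avoids (p ∘ₚ p) q

pattern312 : Permutation′ 3
pattern312 = permutation to from to∘from from∘to
  where
  to : Fin 3 → Fin 3
  to 0F = 2F
  to 1F = 0F
  to 2F = 1F

  from : Fin 3 → Fin 3
  from 0F = 1F
  from 1F = 2F
  from 2F = 0F

  to∘from : ∀ i → to (from i) ≡ i
  to∘from 0F = refl
  to∘from 1F = refl
  to∘from 2F = refl

  from∘to : ∀ i → from (to i) ≡ i
  from∘to 0F = refl
  from∘to 1F = refl
  from∘to 2F = refl

-- One-line notation p₁ ⋯ pₙ, with entries in {1,…,n}.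
oneLine : ∀ {n} → Permutation′ n → List ℕ
oneLine p = tabulate (λ i → suc (toℕ (p ⟨$⟩ʳ i)))

-- The word (k+1)(k+2)⋯n k(k-1)⋯2 1, for k ≤ n.
risingThenFalling : ℕ → ℕ → List ℕ
risingThenFalling n k = map (λ j → k + 1 + j) (upTo (n ∸ k)) ++ map suc (downFrom k)

{-# OPTIONS --safe #-}
-- Number positions and values from 0, so that p m = 0 with m = n − 1, and put
-- c = p 0.  As p² ends in c, avoidance by p² forces the values below c to
-- occupy exactly the first c positions of p².  Hence the maximal value of p
-- occurs before position c, and since p c = p² 0 < c, everything in p from
-- position c onwards lies below c; the values below c decrease because they
-- follow c, so p j = m − j for j ≥ c.  Feeding this back into p², the positions
-- of p with values below c are exactly those from n − c on.  Finally a descent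
-- p i > p i′ with 0 < i < i′ < n − c would put a 312 at 0, i, i′ in p², because
-- p reverses the order of the values from c on.
module Submission where

open import Defs
open import Data.Fin.Base using (Fin; zero; suc; toℕ; fromℕ; fromℕ<; inject≤)
open import Data.Fin.Patterns using (0F; 1F; 2F)
open import Data.Fin.Permutation
  using (Permutation′; _⟨$⟩ʳ_; _⟨$⟩ˡ_; _∘ₚ_; flip; inverseʳ)
open import Data.Fin.Properties
  using (toℕ-injective; toℕ<n; toℕ≤pred[n]; toℕ-fromℕ; toℕ-fromℕ<; toℕ-inject≤;
         fromℕ<-injective; inject≤-injective; injective⇒≤; ≤fromℕ; <-cmp)
open import Data.List.Base using ([]; _∷_; _++_; applyUpTo; map; downFrom; tabulate)
open import Data.List.Properties using (∷-injective; map-upTo)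
open import Data.Nat.Base using (ℕ; zero; suc; _+_; _*_; _∸_; _≤_; _<_; z≤n; s≤s; s≤s⁻¹; pred)
open import Data.Nat.Properties hiding (<-cmp)
open import Data.Product.Base using (_×_; _,_; ∃-syntax; proj₁; proj₂)
open import Function.Base using (_∘_)
open import Function.Bundles using (_⇔_; mk⇔; Equivalence; Injection)
open import Function.Properties.Inverse using (↔⇒↣)
open import Relation.Binary.Definitions using (tri<; tri≈; tri>)
open import Relation.Binary.PropositionalEquality
open import Relation.Nullary using (¬_; yes; no)
open import Relation.Nullary.Negation using (contradiction)

private
  variable
    n m : ℕ

-- Pigeonhole, and 312 in terms of inequalities.

perm-injective : (r : Permutation′ n) → ∀ {i j} → r ⟨$⟩ʳ i ≡ r ⟨$⟩ʳ j → i ≡ j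
perm-injective r = Injection.injective (↔⇒↣ r)

-- Pigeonhole: restricting `r` to the first `a` positions injects `Fin a` into `Fin b`.
initial-segment-≤ : (r : Permutation′ n) → ∀ {a b} → a ≤ n →
  (∀ i → toℕ i < a → toℕ (r ⟨$⟩ʳ i) < b) → a ≤ b
initial-segment-≤ {n} r {a} {b} a≤n below =
  injective⇒≤ λ {x} {y} eq → inject≤-injective a≤n a≤n x y
    (perm-injective r (toℕ-injective (fromℕ<-injective _ _ (bound x) (bound y) eq)))
  where
  bound : ∀ x → toℕ (r ⟨$⟩ʳ inject≤ x a≤n) < b
  bound x = below _ (subst (_< a) (sym (toℕ-inject≤ x a≤n)) (toℕ<n x))

No312 : Permutation′ n → Set
No312 {n} r = ∀ {i j k : Fin n} → toℕ i < toℕ j → toℕ j < toℕ k →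
  toℕ (r ⟨$⟩ʳ j) < toℕ (r ⟨$⟩ʳ k) → ¬ toℕ (r ⟨$⟩ʳ k) < toℕ (r ⟨$⟩ʳ i)

triple : ∀ {A : Set} → A → A → A → Fin 3 → A
triple x y z 0F = x
triple x y z 1F = y
triple x y z 2F = z

module _ {x y z : Fin n} (x<y : toℕ x < toℕ y) (y<z : toℕ y < toℕ z) where

  triple-mono : ∀ r s → toℕ r < toℕ s → toℕ (triple x y z r) < toℕ (triple x y z s)
  triple-mono 0F 1F _ = x<y
  triple-mono 0F 2F _ = <-trans x<y y<z
  triple-mono 1F 2F _ = y<z
  triple-mono 1F 1F (s≤s ())
  triple-mono 2F 1F (s≤s ())
  triple-mono 2F 2F (s≤s (s≤s ()))

  triple-cancel : ∀ r s → toℕ (triple x y z r) < toℕ (triple x y z s) → toℕ r < toℕ s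
  triple-cancel r s lt with <-cmp r s
  ... | tri< r<s _ _ = r<s
  ... | tri≈ _ refl _ = contradiction lt (<-irrefl refl)
  ... | tri> _ _ s<r = contradiction lt (<-asym (triple-mono s r s<r))

avoids⇒no312 : (r : Permutation′ n) → Avoids r pattern312 → No312 r
avoids⇒no312 r avoids {i} {j} {k} i<j j<k rj<rk rk<ri =
  avoids (triple i j k , triple-mono i<j j<k , order)
  where
  -- The three values in increasing order. The word at `i`, `j`, `k` is this triple composed with
  -- 312, which reduces the order condition to monotonicity.
  sorted : Fin 3 → Fin _
  sorted = triple (r ⟨$⟩ʳ j) (r ⟨$⟩ʳ k) (r ⟨$⟩ʳ i)

  value : ∀ s → r ⟨$⟩ʳ triple i j k s ≡ sorted (pattern312 ⟨$⟩ʳ s)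
  value 0F = refl
  value 1F = refl
  value 2F = refl

  order : ∀ s t → (toℕ (r ⟨$⟩ʳ triple i j k s) < toℕ (r ⟨$⟩ʳ triple i j k t)) ⇔
                  (toℕ (pattern312 ⟨$⟩ʳ s) < toℕ (pattern312 ⟨$⟩ʳ t))
  order s t rewrite value s | value t =
    mk⇔ (triple-cancel rj<rk rk<ri _ _) (triple-mono rj<rk rk<ri _ _)

no312⇒avoids : (r : Permutation′ n) → No312 r → Avoids r pattern312
no312⇒avoids r no312 (i , increasing , order) =
  no312 (increasing 0F 1F (s≤s z≤n)) (increasing 1F 2F (s≤s (s≤s z≤n)))
    (Equivalence.from (order 1F 2F) (s≤s z≤n))
    (Equivalence.from (order 2F 0F) (s≤s (s≤s z≤n)))

-- The last entry of a 312-avoiding permutation.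

module LastEntry {m} (r : Permutation′ (suc m)) (no312 : No312 r) where

  private
    f : Fin (suc m) → ℕ
    f i = toℕ (r ⟨$⟩ʳ i)

    c : ℕ
    c = f (fromℕ m)

    ends : ∀ {i} → f i ≡ c → i ≡ fromℕ m
    ends = perm-injective r ∘ toℕ-injective

  -- Were `i` first, then `i`, `j` and the last position would form a 312, with `c` as its 2.
  small-before-large : ∀ {i j} → c < f i → f j < c → toℕ j < toℕ i
  small-before-large {i} {j} c<fi fj<c with <-cmp i j
  ... | tri> _ _ j<i = j<i
  ... | tri≈ _ refl _ = contradiction c<fi (<-asym fj<c)
  ... | tri< i<j _ _ = contradiction c<fi (no312 i<j j<last fj<c)
    where
    j<last : toℕ j < toℕ (fromℕ m)
    j<last = ≤∧≢⇒< (≤fromℕ j) λ eq → <⇒≢ fj<c (cong f (toℕ-injective eq))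

  -- An entry above `c` would have to come after `i`, and `c` itself sits last, so the positions up
  -- to `i` all hold values below `c`; now count.
  small⇒early : ∀ i → f i < c → toℕ i < c
  small⇒early i fi<c = initial-segment-≤ r (toℕ<n i) below
    where
    below : ∀ l → toℕ l < suc (toℕ i) → f l < c
    below l l≤i with f l <? c
    ... | yes fl<c = fl<c
    ... | no fl≮c = contradiction (s≤s⁻¹ l≤i) (<⇒≱ (small-before-large c<fl fi<c))
      where
      c≢fl : c ≢ f l
      c≢fl eq = <⇒≢ fi<c (cong f (toℕ-injective
        (≤-antisym (≤fromℕ i) (subst (λ x → toℕ x ≤ toℕ i) (ends (sym eq)) (s≤s⁻¹ l≤i)))))

      c<fl : c < f l
      c<fl = ≤∧≢⇒< (≮⇒≥ fl≮c) c≢fl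

  -- An entry above `c` at `i` would come after all `c` smaller values, so pigeonhole for the
  -- inverse gives `c ≤ i`.
  early⇒small : ∀ i → toℕ i < c → f i < c
  early⇒small i i<c with f i <? c
  ... | yes fi<c = fi<c
  ... | no fi≮c = contradiction i<c
    (≤⇒≯ (initial-segment-≤ (flip r) (<⇒≤ (toℕ<n (r ⟨$⟩ʳ fromℕ m))) below))
    where
    c≢fi : c ≢ f i
    c≢fi eq = <⇒≱ i<c (subst (c ≤_) (sym (trans (cong toℕ (ends (sym eq))) (toℕ-fromℕ m)))
                             (toℕ≤pred[n] (r ⟨$⟩ʳ fromℕ m)))

    below : ∀ v → toℕ v < c → toℕ (r ⟨$⟩ˡ v) < toℕ i
    below v v<c = small-before-large (≤∧≢⇒< (≮⇒≥ fi≮c) c≢fi)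
                    (subst (λ x → toℕ x < c) (sym (inverseʳ r)) v<c)

-- From avoidance to the rising and falling blocks.

RiseFall : Permutation′ (suc m) → ℕ → ℕ → Set
RiseFall {m} p a k =
  (∀ i → toℕ i < a → toℕ (p ⟨$⟩ʳ i) ≡ k + toℕ i) ×
  (∀ i → a ≤ toℕ i → toℕ (p ⟨$⟩ʳ i) + toℕ i ≡ m)

antitone : ∀ {x u y v} → x + u ≡ m → y + v ≡ m → u < v → y < x
antitone {m} {x} {u} {y} {v} x+u y+v u<v = +-cancelʳ-< v y x
  (subst (_< x + v) (trans x+u (sym y+v)) (+-monoʳ-< x u<v))

module Forward {m} (p : Permutation′ (suc m)) (p-last : p ⟨$⟩ʳ fromℕ m ≡ zero) (0<m : 0 < m)
  (no312 : No312 p) (no312² : No312 (p ∘ₚ p)) where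

  private
    F : Fin (suc m) → ℕ
    F i = toℕ (p ⟨$⟩ʳ i)

    F² : Fin (suc m) → ℕ
    F² i = F (p ⟨$⟩ʳ i)

    F-injective : ∀ {i j} → F i ≡ F j → i ≡ j
    F-injective = perm-injective p ∘ toℕ-injective

    preimage : ∀ {v} → v ≤ m → ∃[ i ] F i ≡ v
    preimage v≤m = p ⟨$⟩ˡ fromℕ< (s≤s v≤m) ,
      trans (cong toℕ (inverseʳ p)) (toℕ-fromℕ< (s≤s v≤m))

    position : ∀ {v} → v ≤ m → ∃[ i ] toℕ {suc m} i ≡ v
    position v≤m = fromℕ< (s≤s v≤m) , toℕ-fromℕ< (s≤s v≤m)

  first : ℕ
  first = F zero

  private
    c : ℕ
    c = first

    C : Fin (suc m)
    C = p ⟨$⟩ʳ zero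

    c≤m : c ≤ m
    c≤m = toℕ≤pred[n] C

    F-last : F (fromℕ m) ≡ 0
    F-last = cong toℕ p-last

    F²-last : F² (fromℕ m) ≡ c
    F²-last = cong F p-last

    0<c : 0 < c
    0<c = n≢0⇒n>0 λ c≡0 → <⇒≢ 0<m
      (trans (cong toℕ (F-injective {zero} {fromℕ m} (trans c≡0 (sym F-last)))) (toℕ-fromℕ m))

    after-zero : ∀ {i} → F i ≢ c → 0 < toℕ i
    after-zero {zero} F≢c = contradiction refl F≢c
    after-zero {suc i} _ = s≤s z≤n

  F²<c⇒<c : ∀ i → F² i < c → toℕ i < c
  F²<c⇒<c i lt = subst (toℕ i <_) F²-last
    (LastEntry.small⇒early (p ∘ₚ p) no312² i (subst (F² i <_) (sym F²-last) lt))

  <c⇒F²<c : ∀ i → toℕ i < c → F² i < c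
  <c⇒F²<c i lt = subst (F² i <_) F²-last
    (LastEntry.early⇒small (p ∘ₚ p) no312² i (subst (toℕ i <_) (sym F²-last) lt))

  -- Position 0 holds `c`, so an ascent among smaller values would complete a 312.
  small-decreasing : ∀ {i j} → F i < F j → F j < c → toℕ j < toℕ i
  small-decreasing {i} {j} Fi<Fj Fj<c with <-cmp i j
  ... | tri> _ _ j<i = j<i
  ... | tri≈ _ refl _ = contradiction Fi<Fj (<-irrefl refl)
  ... | tri< i<j _ _ =
    contradiction Fj<c (no312 (after-zero (<⇒≢ (<-trans Fi<Fj Fj<c))) i<j Fi<Fj)

  -- The values `v - 1, ..., 0` sit at successively later positions, so at least `v` positions
  -- follow `i`.
  small-position-bound : ∀ v i → F i ≡ v → v < c → v + toℕ i ≤ m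
  small-position-bound zero i _ _ = toℕ≤pred[n] i
  small-position-bound (suc v) i Fi≡ v<c with preimage (<⇒≤ (<-≤-trans (<⇒≤ v<c) c≤m))
  ... | i′ , Fi′≡v = begin
    suc v + toℕ i    ≡⟨ +-suc v (toℕ i) ⟨
    v + suc (toℕ i)  ≤⟨ +-monoʳ-≤ v i<i′ ⟩
    v + toℕ i′       ≤⟨ small-position-bound v i′ Fi′≡v (<⇒≤ v<c) ⟩
    m                ∎
    where
    open ≤-Reasoning
    i<i′ : toℕ i < toℕ i′
    i<i′ = small-decreasing (subst₂ _<_ (sym Fi′≡v) (sym Fi≡) ≤-refl) (subst (_< c) (sym Fi≡) v<c)

  -- The suffix decreases, so `F j` is at least the number of positions after `j`;
  -- `small-position-bound` is the opposite inequality.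
  small-suffix⇒reversed : ∀ t → (∀ j → t ≤ toℕ j → F j < c) →
    ∀ j → t ≤ toℕ j → F j + toℕ j ≡ m
  small-suffix⇒reversed t small j t≤j =
    ≤-antisym (small-position-bound _ j refl (small j t≤j))
      (subst (_≤ F j + toℕ j) (m∸n+n≡m (toℕ≤pred[n] j))
        (+-monoˡ-≤ (toℕ j) (lower (m ∸ toℕ j) j t≤j (m+[n∸m]≡n (toℕ≤pred[n] j)))))
    where
    lower : ∀ d j → t ≤ toℕ j → toℕ j + d ≡ m → d ≤ F j
    lower zero j _ _ = z≤n
    lower (suc d) j t≤j j+d≡m
      with position {suc (toℕ j)} (m+n≤o⇒m≤o _ (≤-reflexive (trans (sym (+-suc _ d)) j+d≡m)))
    ... | j′ , j′≡ = ≤-<-trans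
        (lower d j′ t≤j′ (trans (cong (_+ d) j′≡) (trans (sym (+-suc _ d)) j+d≡m))) Fj′<Fj
      where
      j<j′ : toℕ j < toℕ j′
      j<j′ = ≤-reflexive (sym j′≡)

      t≤j′ : t ≤ toℕ j′
      t≤j′ = ≤-trans t≤j (<⇒≤ j<j′)

      Fj′<Fj : F j′ < F j
      Fj′<Fj = ≤∧≢⇒<
        (≮⇒≥ λ Fj<Fj′ → <-asym j<j′ (small-decreasing Fj<Fj′ (small j′ t≤j′)))
        (λ eq → <⇒≢ j<j′ (cong toℕ (sym (F-injective eq))))

  FC<c : F C < c
  FC<c = <c⇒F²<c zero 0<c

  -- Let `P` hold the maximum `m`. Then `F² P = 0 < c` puts `P` before position `c`, and `F j ≥ c`
  -- would make `m`, `F C`, `F j` a 312 at `P`, `C`, `j`.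
  small-from-c : ∀ j → c ≤ toℕ j → F j < c
  small-from-c j c≤j with F j <? c | preimage {m} ≤-refl
  ... | yes Fj<c | _ = Fj<c
  ... | no Fj≮c | P , FP≡m = contradiction Fj<FP (no312 P<C C<j FC<Fj)
    where
    P<C : toℕ P < c
    P<C = F²<c⇒<c P (subst (_< c) (sym (trans (cong F P↦last) F-last)) 0<c)
      where
      P↦last : p ⟨$⟩ʳ P ≡ fromℕ m
      P↦last = toℕ-injective (trans FP≡m (sym (toℕ-fromℕ m)))

    FC<Fj : F C < F j
    FC<Fj = <-≤-trans FC<c (≮⇒≥ Fj≮c)

    C<j : c < toℕ j
    C<j = ≤∧≢⇒< c≤j λ eq → <⇒≢ FC<Fj (cong F (toℕ-injective eq))

    Fj<FP : F j < F P
    Fj<FP = ≤∧≢⇒< (subst (F j ≤_) (sym FP≡m) (toℕ≤pred[n] (p ⟨$⟩ʳ j)))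
      λ eq → <⇒≢ (<-≤-trans P<C c≤j) (cong toℕ (sym (F-injective eq)))

  reversed-from-c : ∀ j → c ≤ toℕ j → F j + toℕ j ≡ m
  reversed-from-c = small-suffix⇒reversed c small-from-c

  module _ {a} (a+c≡n : a + c ≡ suc m) where

    -- The position `j = m - i` is at least `c`, so `p` sends it to `i` and `F i = F² j`; a value
    -- below `c` would force `j < c`.
    large-prefix : ∀ i → toℕ i < a → c ≤ F i
    large-prefix i i<a with position (m∸n≤m m (toℕ i))
    ... | j , j≡ = subst (c ≤_) (cong F pj≡i)
        (≮⇒≥ λ F²j<c → <⇒≱ (F²<c⇒<c j F²j<c) c≤j)
      where
      i+c≤m : toℕ i + c ≤ m
      i+c≤m = s≤s⁻¹ (subst (suc (toℕ i) + c ≤_) a+c≡n (+-monoˡ-≤ c i<a))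

      c≤j : c ≤ toℕ j
      c≤j = subst (c ≤_) (sym j≡) (m+n≤o⇒m≤o∸n c (subst (_≤ m) (+-comm (toℕ i) c) i+c≤m))

      pj≡i : p ⟨$⟩ʳ j ≡ i
      pj≡i = toℕ-injective (+-cancelʳ-≡ (toℕ j) _ _
        (trans (reversed-from-c j c≤j)
               (sym (trans (cong (toℕ i +_) j≡) (m+[n∸m]≡n (toℕ≤pred[n] i))))))

    a≤c : a ≤ c
    a≤c = ≮⇒≥ λ c<a → <⇒≱ FC<c (large-prefix C c<a)

    -- If `i` is the preimage of `j`, then `F j = F² i`. Were `c ≤ i`, reversal would give
    -- `j + i = m`, against `a + c = m + 1`.
    small-suffix : ∀ j → a ≤ toℕ j → F j < c
    small-suffix j a≤j with preimage (toℕ≤pred[n] j)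
    ... | i , Fi≡j = subst (_< c) (cong F (toℕ-injective Fi≡j)) (<c⇒F²<c i (≰⇒> c≰i))
      where
      c≰i : ¬ c ≤ toℕ i
      c≰i c≤i = <-irrefl refl (begin-strict
        m              <⟨ n<1+n m ⟩
        suc m          ≡⟨ a+c≡n ⟨
        a + c          ≤⟨ +-mono-≤ a≤j c≤i ⟩
        toℕ j + toℕ i  ≡⟨ cong (_+ toℕ i) Fi≡j ⟨
        F i + toℕ i    ≡⟨ reversed-from-c i c≤i ⟩
        m              ∎)
        where open ≤-Reasoning

    reversed-suffix : ∀ j → a ≤ toℕ j → F j + toℕ j ≡ m
    reversed-suffix = small-suffix⇒reversed a small-suffix

    prefix-increasing : ∀ {i i′} → toℕ i < toℕ i′ → toℕ i′ < a → F i < F i′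
    prefix-increasing {i} {i′} i<i′ i′<a with <-cmp (p ⟨$⟩ʳ i) (p ⟨$⟩ʳ i′)
    ... | tri< lt _ _ = lt
    ... | tri≈ _ eq _ = contradiction (cong toℕ (perm-injective p eq)) (<⇒≢ i<i′)
    -- Here `c < F i′ < F i`, and `p` reverses order from position `c` on, so `F² 0 > F² i′ > F² i`.
    ... | tri> _ _ Fi′<Fi = contradiction
        (reversing ≤-refl c<Fi′)
        (no312² 0<i i<i′ (reversing c≤Fi′ Fi′<Fi))
      where
      c≤Fi′ : c ≤ F i′
      c≤Fi′ = large-prefix i′ i′<a

      c<Fi′ : c < F i′
      c<Fi′ = ≤∧≢⇒< c≤Fi′ λ eq →
        n≮0 (subst (λ x → toℕ i < toℕ x) (sym (F-injective {zero} eq)) i<i′)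

      0<i : 0 < toℕ i
      0<i = after-zero (>⇒≢ (≤-<-trans c≤Fi′ Fi′<Fi))

      reversing : ∀ {u v} → c ≤ toℕ u → toℕ u < toℕ v → F v < F u
      reversing {u} {v} c≤u u<v =
        antitone (reversed-from-c u c≤u) (reversed-from-c v (≤-trans c≤u (<⇒≤ u<v))) u<v

    -- Strict increase gains at least one per position, starting from at least `c`.
    prefix-lower : ∀ d i → toℕ i ≡ d → toℕ i < a → c + d ≤ F i
    prefix-lower zero i _ i<a = subst (_≤ F i) (sym (+-identityʳ c)) (large-prefix i i<a)
    prefix-lower (suc d) i i≡ i<a
      with position {d}
        (≤-trans (≤-trans (n≤1+n d) (≤-reflexive (sym i≡))) (toℕ≤pred[n] i))
    ... | i′ , i′≡d = subst (_≤ F i) (sym (+-suc c d))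
        (≤-<-trans (prefix-lower d i′ i′≡d (<-trans i′<i i<a)) (prefix-increasing i′<i i<a))
      where
      i′<i : toℕ i′ < toℕ i
      i′<i = subst₂ _<_ (sym i′≡d) (sym i≡) ≤-refl

    -- The values `c + d - 1, ..., c` lie in the increasing prefix at successively earlier
    -- positions, so at least `d` positions precede `i`.
    large-position-bound : ∀ d i → F i ≡ c + d → d ≤ toℕ i
    large-position-bound zero i _ = z≤n
    large-position-bound (suc d) i Fi≡
      with preimage {c + d} (≤-trans (+-monoʳ-≤ c (n≤1+n d))
        (≤-trans (≤-reflexive (sym Fi≡)) (toℕ≤pred[n] (p ⟨$⟩ʳ i))))
    ... | i′ , Fi′≡ = ≤-<-trans (large-position-bound d i′ Fi′≡) i′<i
      where
      Fi′<Fi : F i′ < F i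
      Fi′<Fi = subst₂ _<_ (sym Fi′≡) (sym Fi≡) (+-monoʳ-< c ≤-refl)

      i′<a : toℕ i′ < a
      i′<a = ≰⇒> λ a≤i′ → <⇒≱ (small-suffix i′ a≤i′) (subst (c ≤_) (sym Fi′≡) (m≤m+n c d))

      i′<i : toℕ i′ < toℕ i
      i′<i with <-cmp i′ i
      ... | tri< lt _ _ = lt
      ... | tri≈ _ refl _ = contradiction Fi′<Fi (<-irrefl refl)
      ... | tri> _ _ i<i′ = contradiction Fi′<Fi (<-asym (prefix-increasing i<i′ i′<a))

    riseFall : RiseFall p a c
    riseFall = rise , reversed-suffix
      where
      rise : ∀ i → toℕ i < a → F i ≡ c + toℕ i
      rise i i<a = ≤-antisym
        (subst (_≤ c + toℕ i) split (+-monoʳ-≤ c (large-position-bound (F i ∸ c) i (sym split))))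
        (prefix-lower (toℕ i) i refl i<a)
        where
        split : c + (F i ∸ c) ≡ F i
        split = m+[n∸m]≡n (large-prefix i i<a)

-- From the two blocks back to avoidance.

module Backward {m a k} (p : Permutation′ (suc m)) (a+k≡n : a + k ≡ suc m) (a≤k : a ≤ k)
  (riseFall : RiseFall p a k) where

  private
    F : Fin (suc m) → ℕ
    F i = toℕ (p ⟨$⟩ʳ i)

    F² : Fin (suc m) → ℕ
    F² i = F (p ⟨$⟩ʳ i)

    rise = proj₁ riseFall
    fall = proj₂ riseFall

  -- The block of `j` decides: in the rising one there is no descent from `i` to `j`, in the falling
  -- one no ascent from `j` to `l`.
  no312 : No312 p
  no312 {i} {j} {l} i<j j<l Fj<Fl Fl<Fi with toℕ j <? a
  ... | yes j<a = <-asym (<-trans Fj<Fl Fl<Fi)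
    (subst₂ _<_ (sym (rise i (<-trans i<j j<a))) (sym (rise j j<a)) (+-monoʳ-< k i<j))
  ... | no j≮a = <-asym Fj<Fl
    (antitone (fall j (≮⇒≥ j≮a)) (fall l (≤-trans (≮⇒≥ j≮a) (<⇒≤ j<l))) j<l)

  -- p² reverses the blocks [0,a) and [k,n) and fixes [a,k) pointwise, so all its
  -- inversions lie inside a reversed block; a 312 would put its ascent 12 there too.
  square-initial : ∀ i → toℕ i < a → suc (F² i + toℕ i) ≡ a
  square-initial i i<a = +-cancelʳ-≡ k _ _ (begin
    suc (F² i + toℕ i) + k    ≡⟨ cong suc (+-assoc (F² i) (toℕ i) k) ⟩
    suc (F² i + (toℕ i + k))  ≡⟨ cong (λ x → suc (F² i + x)) (+-comm (toℕ i) k) ⟩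
    suc (F² i + (k + toℕ i))  ≡⟨ cong (λ x → suc (F² i + x)) (rise i i<a) ⟨
    suc (F² i + F i)          ≡⟨ cong suc (fall _ a≤Fi) ⟩
    suc m                     ≡⟨ a+k≡n ⟨
    a + k                     ∎)
    where
    open ≡-Reasoning
    a≤Fi : a ≤ F i
    a≤Fi = subst (a ≤_) (sym (rise i i<a)) (≤-trans a≤k (m≤m+n k (toℕ i)))

  -- Both `i` and `F i` lie in the falling block, where `p` is the reflection taking `x` to `m - x`.
  square-middle : ∀ i → a ≤ toℕ i → toℕ i < k → F² i ≡ toℕ i
  square-middle i a≤i i<k = +-cancelʳ-≡ (F i) _ _
    (trans (fall _ a≤Fi) (trans (sym (fall i a≤i)) (+-comm (F i) (toℕ i))))
    where
    a≤Fi : a ≤ F i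
    a≤Fi = +-cancelʳ-≤ (toℕ i) a (F i) (s≤s⁻¹ (begin
      suc (a + toℕ i)  ≡⟨ +-suc a (toℕ i) ⟨
      a + suc (toℕ i)  ≤⟨ +-monoʳ-≤ a i<k ⟩
      a + k            ≡⟨ a+k≡n ⟩
      suc m            ≡⟨ cong suc (fall i a≤i) ⟨
      suc (F i + toℕ i) ∎))
      where open ≤-Reasoning

  -- The fall sends `i` to `m - i < a`, and the rise then adds `k`.
  square-final : ∀ i → k ≤ toℕ i → F² i + toℕ i ≡ k + m
  square-final i k≤i = begin
    F² i + toℕ i         ≡⟨ cong (_+ toℕ i) (rise _ Fi<a) ⟩
    k + F i + toℕ i      ≡⟨ +-assoc k (F i) (toℕ i) ⟩
    k + (F i + toℕ i)    ≡⟨ cong (k +_) (fall i (≤-trans a≤k k≤i)) ⟩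
    k + m                ∎
    where
    open ≡-Reasoning
    Fi<a : F i < a
    Fi<a = +-cancelʳ-≤ (toℕ i) (suc (F i)) a (≤-trans
      (≤-reflexive (trans (cong suc (fall i (≤-trans a≤k k≤i))) (sym a+k≡n)))
      (+-monoʳ-≤ a k≤i))

  square-final-≥ : ∀ i → k ≤ toℕ i → k ≤ F² i
  square-final-≥ i k≤i = +-cancelʳ-≤ (toℕ i) k (F² i)
    (subst (k + toℕ i ≤_) (sym (square-final i k≤i)) (+-monoʳ-≤ k (toℕ≤pred[n] i)))

  square-≥ : ∀ i → a ≤ toℕ i → a ≤ F² i
  square-≥ i a≤i with toℕ i <? k
  ... | yes i<k = subst (a ≤_) (sym (square-middle i a≤i i<k)) a≤i
  ... | no i≮k = ≤-trans a≤k (square-final-≥ i (≮⇒≥ i≮k))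

  no312-square : No312 (p ∘ₚ p)
  no312-square {i} {j} {l} i<j j<l Fj<Fl Fl<Fi with toℕ i <? a
  -- The value at `l` is below `F² i < a`, so `l` is in the first block too, and `j` lies between
  -- `i` and `l`.
  ... | yes i<a = <-asym Fj<Fl
    (antitone (cong pred (square-initial j j<a)) (cong pred (square-initial l l<a)) j<l)
    where
    F²i<a : F² i < a
    F²i<a = subst (F² i <_) (square-initial i i<a) (s≤s (m≤m+n _ _))

    l<a : toℕ l < a
    l<a = ≰⇒> λ a≤l → <⇒≱ (<-trans Fl<Fi F²i<a) (square-≥ l a≤l)

    j<a : toℕ j < a
    j<a = <-trans j<l l<a
  ... | no i≮a with toℕ i <? k
  ...   | no i≮k = <-asym Fj<Fl
    (antitone (square-final j k≤j) (square-final l (≤-trans k≤j (<⇒≤ j<l))) j<l)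
    where
    k≤j : k ≤ toℕ j
    k≤j = ≤-trans (≮⇒≥ i≮k) (<⇒≤ i<j)
  -- Now `F² i = i`, while every later position is fixed or has a value of at least `k`.
  ...   | yes i<k = <⇒≱ F²j<i i≤F²j
    where
    F²j<i : F² j < toℕ i
    F²j<i = subst (F² j <_) (square-middle i (≮⇒≥ i≮a) i<k) (<-trans Fj<Fl Fl<Fi)

    i≤F²j : toℕ i ≤ F² j
    i≤F²j with toℕ j <? k
    ... | yes j<k = subst (toℕ i ≤_)
        (sym (square-middle j (≤-trans (≮⇒≥ i≮a) (<⇒≤ i<j)) j<k)) (<⇒≤ i<j)
    ... | no j≮k = ≤-trans (<⇒≤ i<k) (square-final-≥ j (≮⇒≥ j≮k))

-- One-line words as pointwise equations.

-- The sum is `n`, not `n - 1`, because entries count from 1 and positions from 0.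
tabulate≡falling⇔ : (t : Fin n → ℕ) →
  tabulate t ≡ map suc (downFrom n) ⇔ (∀ i → t i + toℕ i ≡ n)
tabulate≡falling⇔ {zero} t = mk⇔ (λ _ ()) (λ _ → refl)
tabulate≡falling⇔ {suc n} t = mk⇔ to from
  where
  ih : tabulate (t ∘ suc) ≡ map suc (downFrom n) ⇔ (∀ i → t (suc i) + toℕ i ≡ n)
  ih = tabulate≡falling⇔ (t ∘ suc)

  to : tabulate t ≡ map suc (downFrom (suc n)) → ∀ i → t i + toℕ i ≡ suc n
  to eq zero = trans (+-identityʳ (t zero)) (proj₁ (∷-injective eq))
  to eq (suc i) = trans (+-suc (t (suc i)) (toℕ i))
    (cong suc (Equivalence.to ih (proj₂ (∷-injective eq)) i))

  from : (∀ i → t i + toℕ i ≡ suc n) → tabulate t ≡ map suc (downFrom (suc n))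
  from h = cong₂ _∷_ (trans (sym (+-identityʳ (t zero))) (h zero))
    (Equivalence.from ih λ i → suc-injective (trans (sym (+-suc (t (suc i)) (toℕ i))) (h (suc i))))

-- An arbitrary `g` lets the induction on `a` pass to `g ∘ suc`.
tabulate≡rising++falling⇔ : ∀ (g : ℕ → ℕ) a k (t : Fin (a + k) → ℕ) →
  tabulate t ≡ applyUpTo g a ++ map suc (downFrom k) ⇔
  ((∀ i → toℕ i < a → t i ≡ g (toℕ i)) × (∀ i → a ≤ toℕ i → t i + toℕ i ≡ a + k))
tabulate≡rising++falling⇔ g zero k t = mk⇔
  (λ eq → (λ _ ()) , λ i _ → Equivalence.to (tabulate≡falling⇔ t) eq i)
  (λ h → Equivalence.from (tabulate≡falling⇔ t) λ i → proj₂ h i z≤n)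
tabulate≡rising++falling⇔ g (suc a) k t = mk⇔ to from
  where
  Pointwise : Set
  Pointwise = (∀ i → toℕ i < suc a → t i ≡ g (toℕ i)) ×
              (∀ i → suc a ≤ toℕ i → t i + toℕ i ≡ suc a + k)

  ih = tabulate≡rising++falling⇔ (g ∘ suc) a k (t ∘ suc)

  to : tabulate t ≡ applyUpTo g (suc a) ++ map suc (downFrom k) → Pointwise
  to eq = rise , fall
    where
    tail = Equivalence.to ih (proj₂ (∷-injective eq))

    rise : ∀ i → toℕ i < suc a → t i ≡ g (toℕ i)
    rise zero _ = proj₁ (∷-injective eq)
    rise (suc i) i<a = proj₁ tail i (s≤s⁻¹ i<a)

    fall : ∀ i → suc a ≤ toℕ i → t i + toℕ i ≡ suc a + k
    fall (suc i) a≤i = trans (+-suc (t (suc i)) (toℕ i)) (cong suc (proj₂ tail i (s≤s⁻¹ a≤i)))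

  from : Pointwise → tabulate t ≡ applyUpTo g (suc a) ++ map suc (downFrom k)
  from (rise , fall) = cong₂ _∷_ (rise zero (s≤s z≤n)) (Equivalence.from ih
    ( (λ i i<a → rise (suc i) (s≤s i<a))
    , λ i a≤i → suc-injective (trans (sym (+-suc (t (suc i)) (toℕ i))) (fall (suc i) (s≤s a≤i)))))

oneLine≡risingThenFalling⇔ : ∀ (p : Permutation′ (suc m)) {k} → k ≤ suc m →
  oneLine p ≡ risingThenFalling (suc m) k ⇔ RiseFall p (suc m ∸ k) k
oneLine≡risingThenFalling⇔ {m} p {k} k≤n = mk⇔ to from
  where
  a : ℕ
  a = suc m ∸ k

  t : Fin (suc m) → ℕ
  t i = suc (toℕ (p ⟨$⟩ʳ i))

  -- A variable length allows matching on `refl`, as `suc m ∸ k + k` does not reduce to `suc m`.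
  transport : ∀ {n} (t : Fin n → ℕ) → a + k ≡ n →
    tabulate t ≡ applyUpTo (λ j → k + 1 + j) a ++ map suc (downFrom k) ⇔
    ((∀ i → toℕ i < a → t i ≡ k + 1 + toℕ i) × (∀ i → a ≤ toℕ i → t i + toℕ i ≡ n))
  transport t refl = tabulate≡rising++falling⇔ _ a k t

  word = transport t (m∸n+n≡m k≤n)

  word≡ : risingThenFalling (suc m) k ≡ applyUpTo (λ j → k + 1 + j) a ++ map suc (downFrom k)
  word≡ = cong (_++ map suc (downFrom k)) (map-upTo _ a)

  shift : ∀ j → k + 1 + j ≡ suc (k + j)
  shift j = cong (_+ j) (+-comm k 1)

  to : oneLine p ≡ risingThenFalling (suc m) k → RiseFall p a k
  to eq with Equivalence.to word (trans eq word≡)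
  ... | rise , fall = (λ i i<a → suc-injective (trans (rise i i<a) (shift (toℕ i))))
                    , λ i a≤i → suc-injective (fall i a≤i)

  from : RiseFall p a k → oneLine p ≡ risingThenFalling (suc m) k
  from (rise , fall) = trans (Equivalence.from word
    ( (λ i i<a → trans (cong suc (rise i i<a)) (sym (shift (toℕ i))))
    , λ i a≤i → cong suc (fall i a≤i))) (sym word≡)

theorem3p1 : ∀ (m : ℕ) → let n = suc m in
    (p : Permutation′ n) → p ⟨$⟩ʳ fromℕ m ≡ zero →
    StronglyAvoids p pattern312 ⇔
    (∃[ k ] n ≤ 2 * k × k ≤ n × oneLine p ≡ risingThenFalling n k)
theorem3p1 m p p-last = mk⇔ (forward m p p-last) backward
  where
  forward : ∀ m (p : Permutation′ (suc m)) → p ⟨$⟩ʳ fromℕ m ≡ zero → StronglyAvoids p pattern312 →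
    ∃[ k ] suc m ≤ 2 * k × k ≤ suc m × oneLine p ≡ risingThenFalling (suc m) k
  -- For `n = 1` the 0-based first entry is 0, and `k = 0` would violate `n ≤ 2 * k`.
  forward zero p p-last _ = 1 , s≤s z≤n , ≤-refl , cong (λ x → suc (toℕ x) ∷ []) p-last
  forward (suc m) p p-last (avoids , avoids²) =
    k , n≤2k , k≤n , Equivalence.from (oneLine≡risingThenFalling⇔ p k≤n) (F.riseFall a+k≡n)
    where
    module F = Forward p p-last (s≤s z≤n) (avoids⇒no312 p avoids) (avoids⇒no312 (p ∘ₚ p) avoids²)
    -- The word starts with `k + 1`, which is `k` counted from 0. The decreasing word, given by both
    -- `k = n - 1` and `k = n`, receives `n - 1`.
    k = F.first
    k≤n : k ≤ suc (suc m)
    k≤n = <⇒≤ (toℕ<n (p ⟨$⟩ʳ zero))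

    a+k≡n : suc (suc m) ∸ k + k ≡ suc (suc m)
    a+k≡n = m∸n+n≡m k≤n

    n≤2k : suc (suc m) ≤ 2 * k
    n≤2k = subst₂ _≤_ a+k≡n (cong (k +_) (sym (+-identityʳ k))) (+-monoˡ-≤ k (F.a≤c a+k≡n))

  backward : (∃[ k ] suc m ≤ 2 * k × k ≤ suc m × oneLine p ≡ risingThenFalling (suc m) k) →
    StronglyAvoids p pattern312
  backward (k , n≤2k , k≤n , eq) = no312⇒avoids p B.no312 , no312⇒avoids (p ∘ₚ p) B.no312-square
    where
    a≤k : suc m ∸ k ≤ k
    a≤k = m≤n+o⇒m∸n≤o (suc m) k (subst (suc m ≤_) (cong (k +_) (+-identityʳ k)) n≤2k)

    module B = Backward p (m∸n+n≡m k≤n) a≤k (Equivalence.to (oneLine≡risingThenFalling⇔ p k≤n) eq)
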